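{- Let $D$ be any squarefree integer, let $u$ be a positive integer, and let $S$ be the set of all numbers of the form $r+s\sqrt{D}$, where $r$ and $s$ are nonzero rational integers, $\gcd(r,sD)=1$, and $u\mid s$. Let $p$ be any odd prime number. Suppose there exists a positive integer $k$ such that $p^k$ or $-p^k$ is the norm of a number in $S$, and let $t$ be the least such positive integer. If $n$ is a positive integer such that $p^n$ or $-p^n$ is the norm of a number in $S$, then $t\mid n$.
   Context: The norm of $r+s\sqrt{D}$ is $r^2-Ds^2$. The signs for the exponents $t$ and $n$ are independent: for each exponent, either sign is allowed. Here $D$ may be positive or negative. -}

module Defs where

open import Data.Integer using (ℤ; +_; -_; _*_; _-_; 0ℤ; 1ℤ)
open import Data.Integer.Divisibility using (_∣_)
open import Data.Integer.GCD using (gcd)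
open import Data.Nat as ℕ using (ℕ)
open import Data.Product using (_×_; ∃-syntax)
open import Data.Sum using (_⊎_)
open import Level using (0ℓ)
open import Relation.Binary.PropositionalEquality using (_≡_; _≢_)
open import Relation.Unary using (Pred; _∈_)

-- Divisibility is unsigned, so d ∣ 1ℤ says d = ±1. In particular 0 is not
-- squarefree, while 1 and -1 are.
Squarefree : ℤ → Set
Squarefree D = ∀ d → d * d ∣ D → d ∣ 1ℤ

-- r +√ s stands for r + s√D. For squarefree D ≠ 1 the pair (r , s) is determined
-- by this number. For D = 1 it is not, and the norm r² - D s² is that of the
-- formal expression (equivalently, of r + s X in ℤ[X]/(X² - 1)).
record ℤ[√_] (D : ℤ) : Set where
  constructor _+√_
  field
    r s : ℤ

norm : ∀ {D} → ℤ[√ D ] → ℤ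
norm {D} (r +√ s) = r * r - D * (s * s)

S : (D : ℤ) (u : ℕ) → Pred ℤ[√ D ] 0ℓ
S D u (r +√ s) = r ≢ 0ℤ × s ≢ 0ℤ × gcd r (s * D) ≡ 1ℤ × + u ∣ s

IsNormFrom : ∀ {D} → Pred ℤ[√ D ] 0ℓ → ℤ → Set
IsNormFrom A m = ∃[ α ] α ∈ A × norm α ≡ m

PositiveNormExponent : (D : ℤ) (u p : ℕ) → Pred ℕ 0ℓ
PositiveNormExponent D u p k =
  0 ℕ.< k × (IsNormFrom (S D u) (+ (p ℕ.^ k)) ⊎ IsNormFrom (S D u) (- (+ (p ℕ.^ k))))

IsLeast : Pred ℕ 0ℓ → ℕ → Set
IsLeast P t = t ∈ P × (∀ k → k ∈ P → t ℕ.≤ k)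

{-# OPTIONS --safe #-}
module Submission where

-- Let α = r + s√D and β = r′ + s′√D in S have norms ±p^t and ±p^(t+m), m > 0.
-- The product (s′r - r′s)(s′r + r′s) = s′² N(α) - s² N(β) is divisible by p^t,
-- while p, being odd and prime to r and s′, cannot divide both factors; so p^t
-- divides one of them. Replacing α by its conjugate if need be, p^t ∣ s′r - r′s.
-- Then p^t also divides r′r - Ds′s, since r (r′r - Ds′s) = r′ N(α) - Ds (s′r - r′s).
-- So β times the conjugate of α is p^t γ with γ = R + T√D in ℤ[√D] of norm ±p^m.
-- If p divided R it would divide T, and then r′, as N(α) β = p^t α γ; hence γ ∈ S.
-- So the exponents are closed under subtracting t, and n must reach t exactly.

open import Defs
open import Data.Integer using (ℤ; +_; -_; ∣_∣; 0ℤ; _*_; _-_; _+_)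
import Data.Integer.Divisibility.Signed as ℤ∣
open import Data.Integer.Divisibility.Signed using (divides; ∣⇒∣ᵤ; ∣ᵤ⇒∣) renaming (_∣_ to _∣ℤ_)
import Data.Integer.Properties as ℤ
open import Data.Integer.Tactic.RingSolver using (solve-∀)
open import Data.Nat using (ℕ; zero; suc; _<_; _^_; NonZero; z<s)
import Data.Nat as ℕ
open import Data.Nat.Coprimality as Coprimality using (Coprime; coprime-divisor)
open import Data.Nat.Divisibility using (_∣_)
import Data.Nat.Divisibility as ℕ∣
open import Data.Nat.GCD using (gcd)
open import Data.Nat.Induction using (<-rec)
open import Data.Nat.Primality using (Prime; euclidsLemma; prime⇒irreducible; prime⇒nonZero; ¬prime[1]; irreducible[2])
import Data.Nat.Properties as ℕ
open import Data.Product using (_×_; _,_; ∃-syntax)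
open import Data.Sum using (_⊎_; inj₁; inj₂; [_,_]′; reduce)
open import Function using (_∘_)
open import Relation.Binary.PropositionalEquality
  using (_≡_; refl; sym; trans; cong; cong₂; subst; module ≡-Reasoning)
open import Relation.Nullary using (¬_; yes; no; contradiction)
open import Relation.Unary using (_∈_)

infix 5 _,ₙ_

private
  variable
    D : ℤ
    k p u : ℕ

-- Absolute values and conjugation.

∣i∣≡n⇒i≡±n : ∀ {i n} → ∣ i ∣ ≡ n → i ≡ + n ⊎ i ≡ - (+ n)
∣i∣≡n⇒i≡±n {i} refl with ℤ.+∣i∣≡i⊎+∣i∣≡-i i
... | inj₁ +∣i∣≡i  = inj₁ (sym +∣i∣≡i)
... | inj₂ +∣i∣≡-i = inj₂ (trans (sym (ℤ.neg-involutive i)) (cong -_ (sym +∣i∣≡-i)))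

i-[i-j]≡j : ∀ i j → i - (i - j) ≡ j
i-[i-j]≡j = solve-∀

abs-*-cong : ∀ {m n} i j → ∣ i ∣ ≡ m → ∣ j ∣ ≡ n → ∣ i * j ∣ ≡ m ℕ.* n
abs-*-cong i j ∣i∣≡m ∣j∣≡n = trans (ℤ.abs-* i j) (cong₂ ℕ._*_ ∣i∣≡m ∣j∣≡n)

-- Norms are known only up to sign, so common factors are cancelled between absolute values.
abs-cancelʳ : ∀ {m n} i k {j} .{{_ : NonZero n}} → i * k ≡ j → ∣ k ∣ ≡ n → ∣ j ∣ ≡ m ℕ.* n → ∣ i ∣ ≡ m
abs-cancelʳ {m} {n} i k ik≡j ∣k∣≡n ∣j∣≡mn = ℕ.*-cancelʳ-≡ ∣ i ∣ m n
  (trans (sym (abs-*-cong i k refl ∣k∣≡n)) (trans (cong ∣_∣ ik≡j) ∣j∣≡mn))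

-- Forgetting the sign of the norm merges the two alternatives of `PositiveNormExponent`, and
-- absolute values multiply without a case split.
record PrimePowerNorm (D : ℤ) (u p k : ℕ) (α : ℤ[√ D ]) : Set where
  constructor _,ₙ_
  field
    ∈S     : α ∈ S D u
    ∣norm∣ : ∣ norm α ∣ ≡ p ^ k

positiveNormExponent⇒norm : k ∈ PositiveNormExponent D u p → ∃[ α ] PrimePowerNorm D u p k α
positiveNormExponent⇒norm (_ , inj₁ (α , α∈S , Nα)) = α , α∈S ,ₙ cong ∣_∣ Nα
positiveNormExponent⇒norm (_ , inj₂ (α , α∈S , Nα)) = α , α∈S ,ₙ trans (cong ∣_∣ Nα) (ℤ.∣-i∣≡∣i∣ (+ _))

norm⇒positiveNormExponent : 0 < k → ∃[ α ] PrimePowerNorm D u p k α → k ∈ PositiveNormExponent D u p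
norm⇒positiveNormExponent 0<k (α , α∈S ,ₙ Nα) with ∣i∣≡n⇒i≡±n Nα
... | inj₁ Nα≡ = 0<k , inj₁ (α , α∈S , Nα≡)
... | inj₂ Nα≡ = 0<k , inj₂ (α , α∈S , Nα≡)

conj : ℤ[√ D ] → ℤ[√ D ]
conj (r +√ s) = r +√ (- s)

norm-conj : (α : ℤ[√ D ]) → norm (conj α) ≡ norm α
norm-conj {D} (r +√ s) = identity D r s
  where
  identity : ∀ D r s → r * r - D * (- s * - s) ≡ r * r - D * (s * s)
  identity = solve-∀

conj∈S : {α : ℤ[√ D ]} → α ∈ S D u → conj α ∈ S D u
conj∈S {D} {u} {r +√ s} (r≢0 , s≢0 , gcd≡1 , u∣s) =
  r≢0
  , s≢0 ∘ ℤ.neg-injective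
  , trans (cong (λ i → + gcd ∣ r ∣ i) ∣-sD∣≡∣sD∣) gcd≡1
  , subst (u ∣_) (sym (ℤ.∣-i∣≡∣i∣ s)) u∣s
  where
  ∣-sD∣≡∣sD∣ : ∣ - s * D ∣ ≡ ∣ s * D ∣
  ∣-sD∣≡∣sD∣ = trans (cong ∣_∣ (sym (ℤ.neg-distribˡ-* s D))) (ℤ.∣-i∣≡∣i∣ (s * D))

-- Divisibility by a prime and its powers.

module _ (p-prime : Prime p) where

  prime-∣* : ∀ i j → + p ∣ℤ i * j → + p ∣ℤ i ⊎ + p ∣ℤ j
  prime-∣* i j p∣ij with euclidsLemma ∣ i ∣ ∣ j ∣ p-prime (subst (p ∣_) (ℤ.abs-* i j) (∣⇒∣ᵤ p∣ij))
  ... | inj₁ p∣i = inj₁ (∣ᵤ⇒∣ p∣i)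
  ... | inj₂ p∣j = inj₂ (∣ᵤ⇒∣ p∣j)

  prime-∣square : ∀ i → + p ∣ℤ i * i → + p ∣ℤ i
  prime-∣square i = reduce ∘ prime-∣* i i

  -- A divisor of `n` is prime to `p`, so if it divides `p ^ suc k` it already divides `p ^ k`;
  -- descend to 1.
  ∤⇒coprime-^ : ∀ {n} k → ¬ p ∣ n → Coprime (p ^ k) n
  ∤⇒coprime-^ zero    p∤n (d∣1 , _)  = ℕ∣.∣1⇒≡1 d∣1
  ∤⇒coprime-^ (suc k) p∤n {d} (d∣p^ , d∣n) = ∤⇒coprime-^ k p∤n (coprime-divisor d-p-coprime d∣p^ , d∣n)
    where
    d-p-coprime : Coprime d p
    d-p-coprime (e∣d , e∣p) with prime⇒irreducible p-prime e∣p
    ... | inj₁ e≡1  = e≡1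
    ... | inj₂ refl = contradiction (ℕ∣.∣-trans e∣d d∣n) p∤n

  ∤⇒^∣*-cancelˡ : ∀ k i {j} → ¬ + p ∣ℤ i → + (p ^ k) ∣ℤ i * j → + (p ^ k) ∣ℤ j
  ∤⇒^∣*-cancelˡ k i {j} p∤i p^k∣ij = ∣ᵤ⇒∣
    (coprime-divisor (∤⇒coprime-^ k (p∤i ∘ ∣ᵤ⇒∣)) (subst (p ^ k ∣_) (ℤ.abs-* i j) (∣⇒∣ᵤ p^k∣ij)))

  -- A factor prime to `p` absorbs no power of `p`, so all of `p ^ k` passes to the other factor.
  p^∣product⇒p^∣factor : ∀ k i j → ¬ (+ p ∣ℤ i × + p ∣ℤ j) → + (p ^ k) ∣ℤ i * j →
                         + (p ^ k) ∣ℤ i ⊎ + (p ^ k) ∣ℤ j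
  p^∣product⇒p^∣factor k i j ¬both p^k∣ij with + p ℤ∣.∣? i
  ... | no  p∤i = inj₂ (∤⇒^∣*-cancelˡ k i p∤i p^k∣ij)
  ... | yes p∣i = inj₁ (∤⇒^∣*-cancelˡ k j (λ p∣j → ¬both (p∣i , p∣j))
    (subst (+ (p ^ k) ∣ℤ_) (ℤ.*-comm i j) p^k∣ij))

  p≢1 : ¬ p ≡ 1
  p≢1 refl = ¬prime[1] p-prime

  p∣p^ : ∀ {k} → 0 < k → p ∣ p ^ k
  p∣p^ {suc k} _ = ℕ∣.m∣m*n (p ^ k)

  -- Elements whose norm is a prime power up to sign.

  p∣norm : ∀ {D k} (α : ℤ[√ D ]) → 0 < k → ∣ norm α ∣ ≡ p ^ k → + p ∣ℤ norm α
  p∣norm _ 0<k Nα = ∣ᵤ⇒∣ (subst (p ∣_) (sym Nα) (p∣p^ 0<k))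

  -- If `p` divided `r`, it would divide Ds² = r² - N(α), hence `s * D`, against gcd(r, sD) = 1.
  p∤r : ∀ {r s} → 0 < k → PrimePowerNorm D u p k (r +√ s) → ¬ + p ∣ℤ r
  p∤r {D = D} {r = r} {s} 0<k ((_ , _ , gcd≡1 , _) ,ₙ Nα) p∣r =
    p≢1 (Coprimality.gcd≡1⇒coprime (ℤ.+-injective gcd≡1) (∣⇒∣ᵤ p∣r , ∣⇒∣ᵤ p∣sD))
    where
    p∣Dss : + p ∣ℤ D * (s * s)
    p∣Dss = subst (+ p ∣ℤ_) (i-[i-j]≡j (r * r) (D * (s * s)))
      (ℤ∣.∣m∣n⇒∣m-n (ℤ∣.∣m⇒∣m*n r p∣r) (p∣norm {D} (r +√ s) 0<k Nα))
    p∣sD : + p ∣ℤ s * D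
    p∣sD = [ ℤ∣.∣n⇒∣m*n s , ℤ∣.∣m⇒∣m*n D ∘ prime-∣square s ]′ (prime-∣* D (s * s) p∣Dss)

  -- Otherwise `p` would divide r² = N(α) + Ds². This keeps `p` out of both `s` and `D`.
  p∤Dss : ∀ {r s} → 0 < k → PrimePowerNorm D u p k (r +√ s) → ¬ + p ∣ℤ D * (s * s)
  p∤Dss {D = D} {r = r} {s} 0<k Nα@(_ ,ₙ ∣Nα∣) p∣Dss = p∤r 0<k Nα
    (prime-∣square r (ℤ∣.∣m+n∣n⇒∣m (p∣norm {D} (r +√ s) 0<k ∣Nα∣) (ℤ∣.∣m⇒∣-m p∣Dss)))

  p∤s : ∀ {r s} → 0 < k → PrimePowerNorm D u p k (r +√ s) → ¬ + p ∣ℤ s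
  p∤s {D = D} {s = s} 0<k Nα p∣s = p∤Dss 0<k Nα (ℤ∣.∣n⇒∣m*n D (ℤ∣.∣m⇒∣m*n s p∣s))

  p∤D : ∀ {r s} → 0 < k → PrimePowerNorm D u p k (r +√ s) → ¬ + p ∣ℤ D
  p∤D {s = s} 0<k Nα p∣D = p∤Dss 0<k Nα (ℤ∣.∣m⇒∣m*n (s * s) p∣D)

  -- A common divisor of `R` and `T * D` divides the norm, hence `p ^ k`; dividing `R`, it is also
  -- prime to `p`, so it is 1.
  ∈S-from-p∤r : ∀ {R T} → 0 < k → ∣ norm {D} (R +√ T) ∣ ≡ p ^ k → ¬ + p ∣ℤ R → u ∣ ∣ T ∣ → R +√ T ∈ S D u
  ∈S-from-p∤r {k} {D} {R = R} {T} 0<k Nγ p∤R u∣T =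
    (λ { refl → p∤R (divides 0ℤ refl) })
    -- With `T` zero the norm would be R², forcing `p` to divide `R`.
    , (λ { refl → p∤R (prime-∣square R (subst (+ p ∣ℤ_) (identity₀ D R) (p∣norm {D} (R +√ 0ℤ) 0<k Nγ))) })
    , cong +_ (Coprimality.coprime⇒gcd≡1 coprime)
    , u∣T
    where
    identity₀ : ∀ D R → R * R - D * (0ℤ * 0ℤ) ≡ R * R
    identity₀ = solve-∀
    identity : ∀ D R T → R * R - T * D * T ≡ R * R - D * (T * T)
    identity = solve-∀
    coprime : Coprime ∣ R ∣ ∣ T * D ∣
    coprime {d} (d∣R , d∣TD) = ∤⇒coprime-^ k (p∤R ∘ ∣ᵤ⇒∣) (d∣p^k , d∣R)
      where
      d∣norm : + d ∣ℤ norm {D} (R +√ T)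
      d∣norm = subst (+ d ∣ℤ_) (identity D R T)
        (ℤ∣.∣m∣n⇒∣m-n (ℤ∣.∣m⇒∣m*n R (∣ᵤ⇒∣ {i = R} d∣R)) (ℤ∣.∣m⇒∣m*n T (∣ᵤ⇒∣ {i = T * D} d∣TD)))
      d∣p^k : d ∣ p ^ k
      d∣p^k = subst (d ∣_) Nγ (∣⇒∣ᵤ d∣norm)

  -- Dividing by an element of norm ±p^t.

  quotient : ∀ {t m r s r′ s′} → 0 < t → 0 < m →
             PrimePowerNorm D u p t (r +√ s) → PrimePowerNorm D u p (t ℕ.+ m) (r′ +√ s′) →
             + (p ^ t) ∣ℤ s′ * r - r′ * s → ∃[ γ ] PrimePowerNorm D u p m γ
  quotient {D} {u} {t} {m} {r} {s} {r′} {s′} 0<t 0<m Hα@((_ , _ , _ , u∣s) ,ₙ Nα) Hβ@((_ , _ , _ , u∣s′) ,ₙ Nβ)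
    P∣y@(divides T y≡TP) = from-x P∣x
    where
    P : ℤ
    P = + (p ^ t)

    -- The coordinates of β times the conjugate of α. Thus `identity-norm` is multiplicativity of
    -- the norm, and `identity-r′` compares first coordinates after multiplying back by α.
    x y : ℤ
    x = r′ * r - D * (s′ * s)
    y = s′ * r - r′ * s

    instance
      _ = prime⇒nonZero p-prime
      p^t≢0 : NonZero (p ^ t)
      p^t≢0 = ℕ.m^n≢0 p t

    identity-x : ∀ D r s r′ s′ →
      r′ * (r * r - D * (s * s)) - (D * s) * (s′ * r - r′ * s) ≡ r * (r′ * r - D * (s′ * s))
    identity-x = solve-∀

    identity-norm : ∀ D r s r′ s′ →
      (r′ * r - D * (s′ * s)) * (r′ * r - D * (s′ * s)) - D * ((s′ * r - r′ * s) * (s′ * r - r′ * s))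
      ≡ (r * r - D * (s * s)) * (r′ * r′ - D * (s′ * s′))
    identity-norm = solve-∀

    identity-r′ : ∀ D r s r′ s′ →
      r * (r′ * r - D * (s′ * s)) + (D * s) * (s′ * r - r′ * s) ≡ (r * r - D * (s * s)) * r′
    identity-r′ = solve-∀

    factor-norm : ∀ D R T P → (R * P) * (R * P) - D * ((T * P) * (T * P)) ≡ (R * R - D * (T * T)) * (P * P)
    factor-norm = solve-∀

    factor-r′ : ∀ r e R T P → r * (R * P) + e * (T * P) ≡ (r * R + e * T) * P
    factor-r′ = solve-∀

    P∣Nα : P ∣ℤ norm {D} (r +√ s)
    P∣Nα = ∣ᵤ⇒∣ (ℕ∣.∣-reflexive (sym Nα))

    P∣x : P ∣ℤ x
    P∣x = ∤⇒^∣*-cancelˡ t r (p∤r 0<t Hα) (subst (P ∣ℤ_) (identity-x D r s r′ s′)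
      (ℤ∣.∣m∣n⇒∣m-n (ℤ∣.∣n⇒∣m*n r′ P∣Nα) (ℤ∣.∣n⇒∣m*n (D * s) P∣y)))

    -- `u` divides `y`, which is T p^t, and is prime to `p` because `u` divides `s` while `p` does
    -- not.
    u∣T : u ∣ ∣ T ∣
    u∣T = coprime-divisor u-P-coprime (subst (u ∣_) (trans (cong ∣_∣ (trans y≡TP (ℤ.*-comm T P))) (ℤ.abs-* P T)) u∣y)
      where
      u∣y : u ∣ ∣ y ∣
      u∣y = ∣⇒∣ᵤ {+ u} (ℤ∣.∣m∣n⇒∣m-n (ℤ∣.∣m⇒∣m*n r (∣ᵤ⇒∣ {i = s′} u∣s′)) (ℤ∣.∣n⇒∣m*n r′ (∣ᵤ⇒∣ {i = s} u∣s)))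
      u-P-coprime : Coprime u (p ^ t)
      u-P-coprime (d∣u , d∣P) =
        ∤⇒coprime-^ t (p∤s 0<t Hα ∘ ∣ᵤ⇒∣) (d∣P , ℕ∣.∣-trans d∣u u∣s)

    from-x : P ∣ℤ x → ∃[ γ ] PrimePowerNorm D u p m γ
    from-x (divides R x≡RP) = R +√ T , ∈S-from-p∤r 0<m Nγ p∤R u∣T ,ₙ Nγ
      where
      open ≡-Reasoning

      norm-product : norm {D} (R +√ T) * (P * P) ≡ norm {D} (r +√ s) * norm {D} (r′ +√ s′)
      norm-product = begin
        norm {D} (R +√ T) * (P * P)                    ≡⟨ factor-norm D R T P ⟨
        (R * P) * (R * P) - D * ((T * P) * (T * P))    ≡⟨ cong₂ (λ i j → i * i - D * (j * j)) x≡RP y≡TP ⟨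
        x * x - D * (y * y)                            ≡⟨ identity-norm D r s r′ s′ ⟩
        norm {D} (r +√ s) * norm {D} (r′ +√ s′)        ∎

      r′-product : (r * R + D * s * T) * P ≡ norm {D} (r +√ s) * r′
      r′-product = begin
        (r * R + D * s * T) * P            ≡⟨ factor-r′ r (D * s) R T P ⟨
        r * (R * P) + D * s * (T * P)      ≡⟨ cong₂ (λ i j → r * i + D * s * j) x≡RP y≡TP ⟨
        r * x + D * s * y                  ≡⟨ identity-r′ D r s r′ s′ ⟩
        norm {D} (r +√ s) * r′             ∎

      powers : p ^ t ℕ.* p ^ (t ℕ.+ m) ≡ p ^ m ℕ.* (p ^ t ℕ.* p ^ t)
      powers = begin
        p ^ t ℕ.* p ^ (t ℕ.+ m)        ≡⟨ cong (p ^ t ℕ.*_) (ℕ.^-distribˡ-+-* p t m) ⟩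
        p ^ t ℕ.* (p ^ t ℕ.* p ^ m)    ≡⟨ ℕ.*-assoc (p ^ t) (p ^ t) (p ^ m) ⟨
        p ^ t ℕ.* p ^ t ℕ.* p ^ m      ≡⟨ ℕ.*-comm (p ^ t ℕ.* p ^ t) (p ^ m) ⟩
        p ^ m ℕ.* (p ^ t ℕ.* p ^ t)    ∎

      -- In absolute value N(γ) p^(2t) = p^t p^(t+m).
      Nγ : ∣ norm {D} (R +√ T) ∣ ≡ p ^ m
      Nγ = abs-cancelʳ (norm {D} (R +√ T)) (P * P) {{ℕ.m*n≢0 (p ^ t) (p ^ t)}} norm-product (ℤ.abs-* P P)
        (trans (abs-*-cong (norm {D} (r +√ s)) (norm {D} (r′ +√ s′)) Nα Nβ) powers)

      -- Since N(α) = ±p^t, cancelling p^t shows that αγ has first coordinate ±r′.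
      ∣r′∣ : ∣ r * R + D * s * T ∣ ≡ ∣ r′ ∣
      ∣r′∣ = abs-cancelʳ (r * R + D * s * T) P r′-product refl
        (trans (abs-*-cong (norm {D} (r +√ s)) r′ Nα refl) (ℕ.*-comm (p ^ t) ∣ r′ ∣))

      p∤R : ¬ + p ∣ℤ R
      -- From N(γ) one gets that `p` divides DT². It cannot divide `D`, by the norm of α, and if it
      -- divided `T` it would divide r′.
      p∤R p∣R = [ p∤D 0<t Hα , p∤r (ℕ.<-≤-trans 0<t (ℕ.m≤m+n t m)) Hβ ∘ p∣r′ ∘ prime-∣square T ]′
        (prime-∣* D (T * T) p∣DTT)
        where
        p∣DTT : + p ∣ℤ D * (T * T)
        p∣DTT = subst (+ p ∣ℤ_) (i-[i-j]≡j (R * R) (D * (T * T)))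
          (ℤ∣.∣m∣n⇒∣m-n (ℤ∣.∣m⇒∣m*n R p∣R) (p∣norm {D} (R +√ T) 0<m Nγ))
        p∣r′ : + p ∣ℤ T → + p ∣ℤ r′
        p∣r′ p∣T = ∣ᵤ⇒∣ (subst (p ∣_) ∣r′∣
          (∣⇒∣ᵤ (ℤ∣.∣m∣n⇒∣m+n (ℤ∣.∣n⇒∣m*n r p∣R) (ℤ∣.∣n⇒∣m*n (D * s) p∣T))))

  -- Subtracting exponents.

  module _ (odd : ¬ 2 ∣ p) where

    p∤2 : ¬ + p ∣ℤ + 2
    p∤2 p∣2 with irreducible[2] (∣⇒∣ᵤ p∣2)
    ... | inj₁ p≡1  = p≢1 p≡1
    ... | inj₂ refl = odd ℕ∣.∣-refl

    exponent-difference : ∀ {t m} → 0 < t → 0 < m →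
      ∃[ α ] PrimePowerNorm D u p t α → ∃[ β ] PrimePowerNorm D u p (t ℕ.+ m) β →
      ∃[ γ ] PrimePowerNorm D u p m γ
    exponent-difference {D} {u} {t} {m} 0<t 0<m (r +√ s , Hα@(α∈S ,ₙ Nα)) (r′ +√ s′ , Hβ@(_ ,ₙ Nβ)) =
      [ quotient 0<t 0<m Hα Hβ
      -- The second factor is written with `- s` so that it is literally the `y` belonging to the
      -- conjugate of α.
      , quotient 0<t 0<m (conj∈S α∈S ,ₙ trans (cong ∣_∣ (norm-conj {D} (r +√ s))) Nα) Hβ
      ]′ (p^∣product⇒p^∣factor t (s′ * r - r′ * s) (s′ * r - r′ * - s) ¬both P∣product)
      where
      identity-product : ∀ D r s r′ s′ →
        (s′ * s′) * (r * r - D * (s * s)) - (s * s) * (r′ * r′ - D * (s′ * s′))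
        ≡ (s′ * r - r′ * s) * (s′ * r - r′ * - s)
      identity-product = solve-∀

      identity-sum : ∀ r s r′ s′ → (s′ * r - r′ * s) + (s′ * r - r′ * - s) ≡ + 2 * (s′ * r)
      identity-sum = solve-∀

      P∣product : + (p ^ t) ∣ℤ (s′ * r - r′ * s) * (s′ * r - r′ * - s)
      P∣product = subst (+ (p ^ t) ∣ℤ_) (identity-product D r s r′ s′)
        (ℤ∣.∣m∣n⇒∣m-n
          (ℤ∣.∣n⇒∣m*n (s′ * s′) (∣ᵤ⇒∣ (ℕ∣.∣-reflexive (sym Nα))))
          (ℤ∣.∣n⇒∣m*n (s * s) (∣ᵤ⇒∣ (subst (p ^ t ∣_) (sym (trans Nβ (ℕ.^-distribˡ-+-* p t m))) (ℕ∣.m∣m*n (p ^ m))))))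

      ¬both : ¬ (+ p ∣ℤ s′ * r - r′ * s × + p ∣ℤ s′ * r - r′ * - s)
      -- The two factors add up to 2s′r.
      ¬both (p∣i , p∣j) =
        [ p∤2
        , [ p∤s (ℕ.<-≤-trans 0<t (ℕ.m≤m+n t m)) Hβ , p∤r 0<t Hα ]′ ∘ prime-∣* s′ r
        ]′ (prime-∣* (+ 2) (s′ * r)
             (subst (+ p ∣ℤ_) (identity-sum r s r′ s′) (ℤ∣.∣m∣n⇒∣m+n p∣i p∣j)))

lemma3p1 : ∀ (D : ℤ) → Squarefree D →
    ∀ (u : ℕ) → 0 < u →
    ∀ (p : ℕ) → Prime p → ¬ (2 ∣ p) →
    ∀ (t : ℕ) → IsLeast (PositiveNormExponent D u p) t →
    ∀ (n : ℕ) → n ∈ PositiveNormExponent D u p →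
    t ∣ n
lemma3p1 D _ u _ p p-prime odd t (t∈E@(0<t , _) , t-least) = <-rec _ step
  where
  E : ℕ → Set
  E = PositiveNormExponent D u p

  step : ∀ n → (∀ {m} → m < n → E m → t ∣ m) → E n → t ∣ n
  step n rec n∈E with ℕ.m≤n⇒∃[o]m+o≡n (t-least n n∈E)
  -- Zero is not an exponent in `E`, so n = t is settled without recursion.
  ... | zero  , refl = ℕ∣.∣-reflexive (sym (ℕ.+-identityʳ t))
  ... | suc m , refl = ℕ∣.∣m∣n⇒∣m+n ℕ∣.∣-refl
    -- The difference is smaller than `n` because `t` is positive.
    (rec (ℕ.m<n+m (suc m) 0<t)
      (norm⇒positiveNormExponent z<s
        (exponent-difference p-prime odd 0<t z<s (positiveNormExponent⇒norm t∈E) (positiveNormExponent⇒norm n∈E))))
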